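{- Let $d$ be a non-negative integer, let $\mathcal{G}$ be a parity game all of whose vertex priorities are at most $d$, and let $\mathcal{T}^{\mathrm{Even}}$ and $\mathcal{T}^{\mathrm{Odd}}$ be ordered trees such that $\mathcal{T}^{\mathrm{Even}}$ embeds the largest Even dominion in $\mathcal{G}$ and $\mathcal{T}^{\mathrm{Odd}}$ embeds the largest Odd dominion in $\mathcal{G}$. Then the universal attractor decomposition algorithm is correct on $\mathcal{G}$ when run on the trees $\mathcal{T}^{\mathrm{Even}}$ and $\mathcal{T}^{\mathrm{Odd}}$; that is: if $d$ is even, then $\mathrm{Univ}_{\mathrm{Even}}(\mathcal{G}, d, \mathcal{T}^{\mathrm{Even}}, \mathcal{T}^{\mathrm{Odd}})$ returns the largest Even dominion in $\mathcal{G}$; and if $d$ is odd, then $\mathrm{Univ}_{\mathrm{Odd}}(\mathcal{G}, d, \mathcal{T}^{\mathrm{Even}}, \mathcal{T}^{\mathrm{Odd}})$ returns the largest Odd dominion in $\mathcal{G}$.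
   Context: **Parity games.** A parity game $\mathcal{G}$ consists of a finite directed graph $(V,E)$ in which every vertex has at least one outgoing edge, a partition $(V_{\mathrm{Even}},V_{\mathrm{Odd}})$ of $V$, and a function $\pi$ assigning to each vertex a non-negative integer, its priority. For $S\subseteq V$, $\mathcal{G}\cap S$ is the substructure induced by $S$, and $\mathcal{G}\setminus S=\mathcal{G}\cap(V\setminus S)$. It is called a subgame if every vertex of $S$ has an outgoing edge to a vertex in $S$. $V^{\mathcal{G}'}$ denotes the vertex set of a subgame $\mathcal{G}'$; a subgame and its vertex set are identified when convenient. The empty game is allowed as a subgame. **Strategies, traps, dominia.** A cycle is even if the highest priority on it is even, and odd otherwise. An Even strategy is a set $\sigma\subseteq E$ such that every $v\in V_{\mathrm{Even}}$ has an outgoing edge in $\sigma$ and every outgoing edge of every $v\in V_{\mathrm{Odd}}$ is in $\sigma$. A set $T$ is a trap for Odd if there is an Even strategy $\sigma$ such that $w\in T$ and $(w,u)\in\sigma$ imply $u\in T$ (then $\sigma$ traps Odd in $T$). A set $D$ is an Even dominion if there is an Even strategy $\sigma$ that traps Odd in $D$ and such that every cycle in the subgraph $(D,\sigma)$ is even. Odd strategies, traps for Even, and Odd dominia are defined by swapping the players (and requiring odd cycles). The empty set counts as a trap and as a dominion. Unions of Even (resp. Odd) dominia are Even (resp. Odd) dominia, so there is a largest Even dominion and a largest Odd dominion. **Attractors.** For $B\subseteq A\subseteq V$, an Even strategy $\sigma$ is an Even reachability strategy to $B$ from $A$ if every infinite path in $(V,\sigma)$ starting in $A$ contains a vertex of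 $B$. $\mathrm{Attr}_{\mathrm{Even}}^{\mathcal{G}}(B)$, the Even attractor to $B$ in $\mathcal{G}$, is the largest set from which there is an Even reachability strategy to $B$. $\mathrm{Attr}_{\mathrm{Odd}}^{\mathcal{G}}(B)$ is defined analogously. **Ordered trees.** An ordered tree is the trivial tree $\langle\rangle$ or a finite sequence $\langle\mathcal{T}_1,\dots,\mathcal{T}_k\rangle$ of ordered trees. Every ordered tree embeds $\langle\rangle$, and $\langle\mathcal{T}_1,\dots,\mathcal{T}_k\rangle$ embeds $\langle\mathcal{T}'_1,\dots,\mathcal{T}'_\ell\rangle$ if there are $1\le i_1<\dots<i_\ell\le k$ such that $\mathcal{T}_{i_j}$ embeds $\mathcal{T}'_j$ for all $j=1,\dots,\ell$. **Attractor decompositions.** Let $e\geq 0$ be even and let $\mathcal{G}$ have all priorities at most $e$. An Even $e$-attractor decomposition of $\mathcal{G}$ is $\mathcal{H}=\langle A,(S_1,\mathcal{H}_1,A_1),\dots,(S_k,\mathcal{H}_k,A_k)\rangle$ such that $A$ is the Even attractor in $\mathcal{G}$ to the set of vertices of priority $e$ and, setting $\mathcal{G}_1=\mathcal{G}\setminus A$, for $i=1,\dots,k$: $S_i$ is a non-empty trap for Odd in $\mathcal{G}_i$ in which every priority is at most $e-2$; $\mathcal{H}_i$ is an Even $(e-2)$-attractor decomposition of $\mathcal{G}\cap S_i$; $A_i$ is the Even attractor to $S_i$ in $\mathcal{G}_i$; $\mathcal{G}_{i+1}=\mathcal{G}_i\setminus A_i$; and $\mathcal{G}_{k+1}$ is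 empty. If $e=0$ then $k=0$ is required. Odd $e$-attractor decompositions, for odd $e$, are defined by swapping the players. The tree of $\mathcal{H}$ is $\mathcal{T}_{\mathcal{H}}=\langle\rangle$ if $k=0$, and $\mathcal{T}_{\mathcal{H}}=\langle\mathcal{T}_{\mathcal{H}_1},\dots,\mathcal{T}_{\mathcal{H}_k}\rangle$ otherwise. **Embedding dominia.** An ordered tree embeds a dominion $D$ of $\mathcal{G}$ if it embeds the tree of some attractor decomposition of $\mathcal{G}\cap D$: for an Even dominion, an Even $e$-attractor decomposition, where $e$ is the least even number $\ge d$; for an Odd dominion, an Odd $e$-attractor decomposition, where $e$ is the least odd number $\geq d$. **Universal attractor decomposition algorithm.** Two mutually recursive procedures. $\mathrm{Univ}_{\mathrm{Even}}(\mathcal{G},d,\mathcal{T}^{\mathrm{Even}},\mathcal{T}^{\mathrm{Odd}})$: let $\mathcal{T}^{\mathrm{Odd}}=\langle\mathcal{T}^{\mathrm{Odd}}_1,\dots,\mathcal{T}^{\mathrm{Odd}}_k\rangle$ and $\mathcal{G}_1=\mathcal{G}$. For $i=1,\dots,k$: $D_i=\pi^{ -1}(d)\cap\mathcal{G}_i$; $\mathcal{G}'_i=\mathcal{G}_i\setminus\mathrm{Attr}_{\mathrm{Even}}^{\mathcal{G}_i}(D_i)$; $U_i=\mathrm{Univ}_{\mathrm{Odd}}(\mathcal{G}'_i,d-1,\mathcal{T}^{\mathrm{Even}},\mathcal{T}^{\mathrm{Odd}}_i)$; $\mathcal{G}_{i+1}=\mathcal{G}_i\setminus\mathrm{Attr}_{\mathrm{Odd}}^{\mathcal{G}_i}(U_i)$.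 Return $V^{\mathcal{G}_{k+1}}$. $\mathrm{Univ}_{\mathrm{Odd}}(\mathcal{G},d,\mathcal{T}^{\mathrm{Even}},\mathcal{T}^{\mathrm{Odd}})$: let $\mathcal{T}^{\mathrm{Even}}=\langle\mathcal{T}^{\mathrm{Even}}_1,\dots,\mathcal{T}^{\mathrm{Even}}_\ell\rangle$ and $\mathcal{G}_1=\mathcal{G}$. For $i=1,\dots,\ell$: $D_i=\pi^{ -1}(d)\cap\mathcal{G}_i$; $\mathcal{G}'_i=\mathcal{G}_i\setminus\mathrm{Attr}_{\mathrm{Odd}}^{\mathcal{G}_i}(D_i)$; $U_i=\mathrm{Univ}_{\mathrm{Even}}(\mathcal{G}'_i,d-1,\mathcal{T}^{\mathrm{Even}}_i,\mathcal{T}^{\mathrm{Odd}})$; $\mathcal{G}_{i+1}=\mathcal{G}_i\setminus\mathrm{Attr}_{\mathrm{Even}}^{\mathcal{G}_i}(U_i)$. Return $V^{\mathcal{G}_{\ell+1}}$. (If the second argument is negative, $\pi^{ -1}(d)=\emptyset$.) -}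

module Defs where

open import Data.Bool.Base using (if_then_else_)
open import Data.Fin.Base using (Fin)
open import Data.Fin.Subset using (Subset; _∈_; _⊆_; _∩_; _─_; Nonempty; Empty)
open import Data.Integer.Base using (ℤ; +_; _-_; 1ℤ)
import Data.Integer.Properties as ℤ
open import Data.List.Base using (List; []; _∷_)
open import Data.List.Relation.Binary.Sublist.Heterogeneous using (Sublist)
open import Data.Nat.Base using (ℕ; suc; _⊔_; _≤_; parity)
open import Data.Parity.Base using (Parity; 0ℙ; 1ℙ; _⁻¹)
import Data.Parity.Properties as ℙ
open import Data.Product.Base using (_×_; ∃)
open import Data.Vec.Base using (tabulate)
open import Relation.Binary.Construct.Closure.Transitive using (TransClosure; [_]; _∷_)
open import Relation.Binary.PropositionalEquality.Core using (_≡_; _≢_)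
open import Relation.Nullary.Decidable.Core using (does)

-- A player is the parity that player wants the highest priority on a cycle to
-- have, so the opponent of P is P ⁻¹ and P likes priority p iff parity p ≡ P.

Player : Set
Player = Parity

pattern Even = 0ℙ
pattern Odd  = 1ℙ

record ParityGame : Set where
  field
    size  : ℕ

  Vertex : Set
  Vertex = Fin size

  Vertices : Set
  Vertices = Subset size

  field
    successors : Vertex → Vertices
    total      : ∀ v → Nonempty (successors v)
    owner      : Vertex → Player
    π          : Vertex → ℕ

  -- A set of edges, as the set of targets of the edges out of each vertex.

  EdgeSet : Set
  EdgeSet = Vertex → Vertices

  -- The priority is an integer because the recursion of the universal
  -- algorithm may pass a negative one, for which this set is empty.

  π⁻¹ : ℤ → Vertices
  π⁻¹ d = tabulate λ v → does ((+ π v) ℤ.≟ d)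

-- Substructures 𝓖 ∩ S are represented by the set S: the argument S below
-- restricts the notion being defined from 𝓖 to 𝓖 ∩ S, and 𝓖 itself is S = ⊤.

module _ (𝓖 : ParityGame) where
  open ParityGame 𝓖

  record IsStrategy (P : Player) (S : Vertices) (σ : EdgeSet) : Set where
    field
      edges    : ∀ {v w} → w ∈ σ v → v ∈ S × w ∈ S × w ∈ successors v
      own      : ∀ {v} → v ∈ S → owner v ≡ P → Nonempty (σ v)
      opponent : ∀ {v w} → v ∈ S → owner v ≢ P →
                 w ∈ S → w ∈ successors v → w ∈ σ v

  -- The P-strategy σ in 𝓖 ∩ S traps the opponent of P in T.

  record Traps (P : Player) (S : Vertices) (σ : EdgeSet) (T : Vertices) : Set where
    field
      strategy : IsStrategy P S σ
      subset   : T ⊆ S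
      closed   : ∀ {w u} → w ∈ T → u ∈ σ w → u ∈ T

  IsTrapFor : Player → Vertices → Vertices → Set
  IsTrapFor Q S T = ∃ λ σ → Traps (Q ⁻¹) S σ T

  Restrict : EdgeSet → Vertices → Vertex → Vertex → Set
  Restrict σ D v w = v ∈ D × w ∈ D × w ∈ σ v

  -- The maximum ranges over all vertices but the last one, which on a closed
  -- walk is also the first one.

  highest : ∀ {R : Vertex → Vertex → Set} {v w} → TransClosure R v w → ℕ
  highest ([_] {v} _)   = π v
  highest (_∷_ {v} _ c) = π v ⊔ highest c

  AllCyclesGood : Player → EdgeSet → Vertices → Set
  AllCyclesGood P σ D =
    ∀ {v} (c : TransClosure (Restrict σ D) v v) → parity (highest c) ≡ P

  IsDominion : Player → Vertices → Vertices → Set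
  IsDominion P S D = ∃ λ σ → Traps P S σ D × AllCyclesGood P σ D

  IsLargestDominion : Player → Vertices → Vertices → Set
  IsLargestDominion P S D =
    IsDominion P S D × (∀ D′ → IsDominion P S D′ → D′ ⊆ D)

  record IsReachabilityStrategy
         (P : Player) (S : Vertices) (σ : EdgeSet) (B A : Vertices) : Set where
    field
      strategy : IsStrategy P S σ
      target   : B ⊆ A
      subset   : A ⊆ S
      reaches  : (path : ℕ → Vertex) → path 0 ∈ A →
                 (∀ i → path (suc i) ∈ σ (path i)) → ∃ λ i → path i ∈ B

  CanReach : Player → Vertices → Vertices → Vertices → Set
  CanReach P S B A = ∃ λ σ → IsReachabilityStrategy P S σ B A

  IsAttractor : Player → Vertices → Vertices → Vertices → Set
  IsAttractor P S B A = CanReach P S B A × (∀ A′ → CanReach P S B A′ → A′ ⊆ A)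

data Tree : Set where
  ⟨_⟩ : List Tree → Tree

data _Embeds_ : Tree → Tree → Set where
  ⟨_⟩ : ∀ {ts us} → Sublist (λ u t → t Embeds u) us ts → ⟨ ts ⟩ Embeds ⟨ us ⟩

module _ (𝓖 : ParityGame) where
  open ParityGame 𝓖

  mutual

    -- P e-attractor decompositions of 𝓖 ∩ S.

    data Decomposition (P : Player) (e : ℕ) (S : Vertices) : Set where
      decomposition : ∀ A → parity e ≡ P → (∀ {v} → v ∈ S → π v ≤ e) →
                      IsAttractor 𝓖 P S (π⁻¹ (+ e) ∩ S) A →
                      Components P e (S ─ A) → Decomposition P e S

    -- The sequences (Sᵢ , 𝓗ᵢ , Aᵢ) , … , (Sₖ , 𝓗ₖ , Aₖ) that decompose
    -- 𝓖ᵢ = 𝓖 ∩ S.  The bound e − 2 on the priorities in Sᵢ is part of 𝓗ᵢ, and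
    -- for e < 2 (where it would exclude the non-empty Sᵢ) only [] is possible.

    data Components (P : Player) : ℕ → Vertices → Set where
      []  : ∀ {e S} → Empty S → Components P e S
      add : ∀ {e S} Sᵢ Aᵢ → Nonempty Sᵢ → IsTrapFor 𝓖 (P ⁻¹) S Sᵢ →
            Decomposition P e Sᵢ → IsAttractor 𝓖 P S Sᵢ Aᵢ →
            Components P (suc (suc e)) (S ─ Aᵢ) → Components P (suc (suc e)) S

  mutual
    tree : ∀ {P e S} → Decomposition P e S → Tree
    tree (decomposition _ _ _ _ cs) = ⟨ trees cs ⟩

    trees : ∀ {P e S} → Components P e S → List Tree
    trees ([] _)                 = []
    trees (add _ _ _ _ 𝓗ᵢ _ cs) = tree 𝓗ᵢ ∷ trees cs

-- The least number of parity P that is at least d.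

level : Player → ℕ → ℕ
level P d = if does (parity d ℙ.≟ P) then d else suc d

EmbedsDominion : (𝓖 : ParityGame) → ℕ → Tree → Player → ParityGame.Vertices 𝓖 → Set
EmbedsDominion 𝓖 d 𝓣 P D =
  ∃ λ (𝓗 : Decomposition 𝓖 P (level P d) D) → 𝓣 Embeds tree 𝓖 𝓗

-- Attractors are characterised by maximality rather than computed, so the
-- algorithm is given by its input-output relation: Univ P S d 𝓣 𝓣′ U says that
-- the procedure of player P returns U on 𝓖 ∩ S, d, the tree 𝓣 of P and the tree
-- 𝓣′ of the opponent, and Loop P S d 𝓣 ts U that its loop does so when started
-- with 𝓖ᵢ = 𝓖 ∩ S and remaining opponent trees ts.

module _ (𝓖 : ParityGame) where
  open ParityGame 𝓖

  mutual
    data Univ (P : Player) (S : Vertices) (d : ℤ) (𝓣 : Tree) :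
              Tree → Vertices → Set where
      run : ∀ {ts U} → Loop P S d 𝓣 ts U → Univ P S d 𝓣 ⟨ ts ⟩ U

    data Loop (P : Player) (S : Vertices) (d : ℤ) (𝓣 : Tree) :
              List Tree → Vertices → Set where
      done : Loop P S d 𝓣 [] S
      step : ∀ {t ts A Uᵢ A′ U} →
             IsAttractor 𝓖 P S (π⁻¹ d ∩ S) A →
             Univ (P ⁻¹) (S ─ A) (d - 1ℤ) t 𝓣 Uᵢ →
             IsAttractor 𝓖 (P ⁻¹) S Uᵢ A′ →
             Loop P (S ─ A′) d 𝓣 ts U →
             Loop P S d 𝓣 (t ∷ ts) U

  UnivEven : Vertices → ℤ → Tree → Tree → Vertices → Set
  UnivEven S d 𝓣ᴱ 𝓣ᴼ = Univ Even S d 𝓣ᴱ 𝓣ᴼ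

  UnivOdd : Vertices → ℤ → Tree → Tree → Vertices → Set
  UnivOdd S d 𝓣ᴱ 𝓣ᴼ = Univ Odd S d 𝓣ᴼ 𝓣ᴱ

-- Termination with U and with no other result.

infix 4 _Returns_

_Returns_ : {X : Set} → (X → Set) → X → Set
Result Returns U = Result U × (∀ {U′} → Result U′ → U′ ≡ U)

{-# OPTIONS --safe #-}
module Submission where

-- Let P be the parity of d and Q its opponent.  By induction on the run of the
-- procedure of P, its result contains every P-dominion that the tree of P embeds
-- and is disjoint from every Q-dominion that the tree of Q embeds.  A P-dominion
-- loses nothing to the loop: what remains of it outside the attractor to priority d
-- is still embedded, so the recursive call excludes it.  A Q-dominion is eaten
-- away component by component: when the tree of the recursive call embeds that of
-- the first component, the call captures this component and the Q-attractor to the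
-- result removes it.  What the loop leaves of a decomposition is a trap for the
-- player owning it, and the decomposition restricts to it with an embedded tree.
-- By Zielonka's argument the largest dominia of P and Q cover the game, hence the
-- result is the largest P-dominion.

open import Defs
open import Data.Bool.Base using (true; false; if_then_else_)
open import Data.Fin.Properties using (any?)
open import Data.Fin.Subset
  using (Subset; _∈_; _∉_; _⊆_; _⊂_; _⊃_; _∩_; _∪_; _─_; ⁅_⁆; Nonempty; Empty; ⊤; ⊥)
open import Data.Fin.Subset.Induction using (Acc; acc; ⊂-wellFounded; ⊃-wellFounded)
open import Data.Fin.Subset.Properties
open import Data.Integer.Base using (ℤ; +_; _-_; 1ℤ)
import Data.Integer.Properties as ℤ
open import Data.List.Base using (List; []; _∷_)
open import Data.List.Relation.Binary.Sublist.Heterogeneous using (Sublist; []; _∷_; _∷ʳ_)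
open import Data.Nat.Base using (ℕ; zero; suc; _⊔_; _≤_; _<_; s≤s⁻¹; parity)
import Data.Nat.Properties as ℕ
open import Data.Parity.Base using (_⁻¹)
import Data.Parity.Properties as ℙ
open import Data.Product.Base using (_×_; _,_; ∃; proj₁; proj₂)
open import Data.Sum.Base using (_⊎_; inj₁; inj₂; [_,_]′)
open import Data.Vec.Base using (tabulate; _∷_; there)
open import Data.Vec.Properties using ([]=⇒lookup; lookup⇒[]=; lookup∘tabulate)
open import Function.Base using (_∘_)
open import Relation.Binary.Construct.Closure.Transitive using (TransClosure; [_]; _∷_; _++_)
open import Relation.Binary.PropositionalEquality
open import Relation.Nullary
  using (¬_; Dec; yes; no; does; contradiction; ¬?; _×-dec_; _→-dec_)
open import Relation.Nullary.Decidable using (dec-true; dec-false)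

private
  variable
    n : ℕ
    P Q R : Player

-- Finite sets and the two players.

Disjoint : Subset n → Subset n → Set
Disjoint p q = ∀ {x} → x ∈ p → x ∉ q

x∈p─q⇒x∉q : ∀ (p q : Subset n) {x} → x ∈ p ─ q → x ∉ q
x∈p─q⇒x∉q (_ ∷ p) (true  ∷ q) (there x∈) (there x∈q) = x∈p─q⇒x∉q p q x∈ x∈q
x∈p─q⇒x∉q (_ ∷ p) (false ∷ q) (there x∈) (there x∈q) = x∈p─q⇒x∉q p q x∈ x∈q

x∉p─q⇒x∈q : ∀ {p q : Subset n} {x} → x ∈ p → x ∉ p ─ q → x ∈ q
x∉p─q⇒x∈q {q = q} {x} x∈p x∉ with x ∈? q
... | yes x∈q = x∈q
... | no  x∉q = contradiction (x∈p∧x∉q⇒x∈p─q x∈p x∉q) x∉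

p≢p⁻¹ : P ≢ P ⁻¹
p≢p⁻¹ {P} = ℙ.p≢p⁻¹ P

≢⇒≡-opponent : P ≢ Q → R ≢ P → R ≡ Q
≢⇒≡-opponent {Even} {Even} P≢Q _   = contradiction refl P≢Q
≢⇒≡-opponent {Odd}  {Odd}  P≢Q _   = contradiction refl P≢Q
≢⇒≡-opponent {Even} {Odd} {Even} _ R≢P = contradiction refl R≢P
≢⇒≡-opponent {Even} {Odd} {Odd}  _ _   = refl
≢⇒≡-opponent {Odd} {Even} {Even} _ _   = refl
≢⇒≡-opponent {Odd} {Even} {Odd}  _ R≢P = contradiction refl R≢P

-- Transitivity of tree embedding.

infix 4 _⊑_

_⊑_ : List Tree → List Tree → Set
us ⊑ ts = Sublist (λ u t → t Embeds u) us ts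

mutual
  Embeds-trans : ∀ {t u w} → t Embeds u → u Embeds w → t Embeds w
  Embeds-trans ⟨ us⊑ts ⟩ ⟨ ws⊑us ⟩ = ⟨ ⊑-trans ws⊑us us⊑ts ⟩

  ⊑-trans : ∀ {ts us ws} → ws ⊑ us → us ⊑ ts → ws ⊑ ts
  ⊑-trans ws⊑us        (t ∷ʳ us⊑ts) = t ∷ʳ ⊑-trans ws⊑us us⊑ts
  ⊑-trans []           []           = []
  ⊑-trans (_ ∷ʳ ws⊑us) (_ ∷ us⊑ts)  = _ ∷ʳ ⊑-trans ws⊑us us⊑ts
  ⊑-trans (w⊑u ∷ ws⊑us) (u⊑t ∷ us⊑ts) = Embeds-trans u⊑t w⊑u ∷ ⊑-trans ws⊑us us⊑ts

does-true⇒ : ∀ {a} {A : Set a} (A? : Dec A) → does A? ≡ true → A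
does-true⇒ (yes a) _ = a

module _ (𝓖 : ParityGame) where
  open ParityGame 𝓖

  private
    variable
      S S′ T X A A′ B D : Vertices
      σ τ : EdgeSet
      u v w : Vertex

  -- Vertices of a given priority.

  ∈π⁻¹⁺ : ∀ {d} → π v ≡ d → v ∈ π⁻¹ (+ d)
  ∈π⁻¹⁺ {v} {d} πv≡d = lookup⇒[]= v _
    (trans (lookup∘tabulate _ v) (dec-true ((+ π v) ℤ.≟ (+ d)) (cong +_ πv≡d)))

  ∈π⁻¹⁻ : ∀ {d} → v ∈ π⁻¹ (+ d) → π v ≡ d
  ∈π⁻¹⁻ {v} {d} v∈ = ℤ.+-injective
    (does-true⇒ ((+ π v) ℤ.≟ (+ d)) (trans (sym (lookup∘tabulate _ v)) ([]=⇒lookup v∈)))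

  -- Strategies, built vertex by vertex.

  record StrategyAt (P : Player) (S : Vertices) (v : Vertex) (N : Vertices) : Set where
    field
      edges    : w ∈ N → v ∈ S × w ∈ S × w ∈ successors v
      own      : v ∈ S → owner v ≡ P → Nonempty N
      opponent : v ∈ S → owner v ≢ P → w ∈ S → w ∈ successors v → w ∈ N

  strategyAt : IsStrategy 𝓖 P S σ → StrategyAt P S v (σ v)
  strategyAt st = record
    { edges = IsStrategy.edges st ; own = IsStrategy.own st ; opponent = IsStrategy.opponent st }

  isStrategy : (∀ v → StrategyAt P S v (σ v)) → IsStrategy 𝓖 P S σ
  isStrategy at = record
    { edges    = λ {v} → StrategyAt.edges (at v)
    ; own      = λ {v} → StrategyAt.own (at v)
    ; opponent = λ {v} → StrategyAt.opponent (at v) }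

  merge : Vertices → EdgeSet → EdgeSet → EdgeSet
  merge X σ τ v = if does (v ∈? X) then σ v else τ v

  merge-∈ : ∀ σ τ → v ∈ X → merge X σ τ v ≡ σ v
  merge-∈ {v} {X} σ τ v∈X with v ∈? X
  ... | yes _  = refl
  ... | no v∉X = contradiction v∈X v∉X

  merge-∉ : ∀ σ τ → v ∉ X → merge X σ τ v ≡ τ v
  merge-∉ {v} {X} σ τ v∉X with v ∈? X
  ... | yes v∈X = contradiction v∈X v∉X
  ... | no _    = refl

  -- The conditions on a strategy concern the edges out of one vertex at a time, so strategies can
  -- be glued along any set.
  merge-strategy : (∀ {v} → v ∈ X → StrategyAt P S v (σ v)) →
                   (∀ {v} → v ∉ X → StrategyAt P S v (τ v)) →
                   IsStrategy 𝓖 P S (merge X σ τ)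
  merge-strategy {X} {P} {S} {σ} {τ} inX outX = isStrategy at
    where
    at : ∀ v → StrategyAt P S v (merge X σ τ v)
    at v with v ∈? X
    ... | yes v∈X = inX v∈X
    ... | no  v∉X = outX v∉X

  -- Subgames and traps.

  IsSubgame : Vertices → Set
  IsSubgame S = ∀ {v} → v ∈ S → ∃ λ w → w ∈ S × w ∈ successors v

  -- Unfolds to the shape of a `merge` with `⊥`, so `merge-strategy` applies. It is the default
  -- strategy of either player, forbidding nothing.
  full : Vertices → EdgeSet
  full S v = if does (v ∈? S) then successors v ∩ S else ⊥

  full-strategy : IsSubgame S → IsStrategy 𝓖 P S (full S)
  full-strategy {S} sub = merge-strategy
    (λ {v} v∈S → record
      { edges    = λ w∈ → let w∈succ , w∈S = x∈p∩q⁻ (successors v) S w∈ in v∈S , w∈S , w∈succ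
      ; own      = λ _ _ → let w , w∈S , w∈succ = sub v∈S in w , x∈p∩q⁺ (w∈succ , w∈S)
      ; opponent = λ _ _ w∈S w∈succ → x∈p∩q⁺ (w∈succ , w∈S) })
    (λ v∉S → record
      { edges    = λ w∈⊥ → contradiction w∈⊥ ∉⊥
      ; own      = λ v∈S → contradiction v∈S v∉S
      ; opponent = λ v∈S → contradiction v∈S v∉S })

  -- As in Traps, P is the player who can keep the play in T.

  record Trap (P : Player) (S T : Vertices) : Set where
    field
      subset   : T ⊆ S
      own      : v ∈ T → owner v ≡ P → ∃ λ w → w ∈ T × w ∈ successors v
      opponent : v ∈ T → owner v ≢ P → w ∈ S → w ∈ successors v → w ∈ T

  Traps⇒Trap : Traps 𝓖 P S σ T → Trap P S T
  Traps⇒Trap {P = P} {S} {σ} {T} tr = record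
    { subset   = subset
    ; own      = λ v∈T o → let w , w∈σ = S.own (subset v∈T) o in
                 w , closed v∈T w∈σ , proj₂ (proj₂ (S.edges w∈σ))
    ; opponent = λ v∈T o w∈S w∈succ → closed v∈T (S.opponent (subset v∈T) o w∈S w∈succ) }
    where
    open Traps tr
    module S = IsStrategy strategy

  -- A vertex of `T` keeps exactly its edges into `T`; every other vertex keeps all its edges in the
  -- subgame.
  Trap⇒Traps : IsSubgame S → Trap P S T → ∃ λ σ → Traps 𝓖 P S σ T
  Trap⇒Traps {S} {P} {T} sub tr = stay , record
    { strategy = merge-strategy
        (λ {v} v∈T → record
          { edges    = λ w∈ → let w∈succ , w∈T = x∈p∩q⁻ (successors v) T w∈ in
                       Tr.subset v∈T , Tr.subset w∈T , w∈succ
          ; own      = λ _ o → let w , w∈T , w∈succ = Tr.own v∈T o in w , x∈p∩q⁺ (w∈succ , w∈T)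
          ; opponent = λ _ o w∈S w∈succ → x∈p∩q⁺ (w∈succ , Tr.opponent v∈T o w∈S w∈succ) })
        (λ _ → strategyAt (full-strategy sub))
    ; subset = Tr.subset
    ; closed = λ {w} {u} w∈T u∈ →
        proj₂ (x∈p∩q⁻ (successors w) T (subst (u ∈_) (merge-∈ inside-T (full S) w∈T) u∈)) }
    where
    module Tr = Trap tr
    inside-T : EdgeSet
    inside-T v = successors v ∩ T
    stay : EdgeSet
    stay = merge T inside-T (full S)

  Trap-refl : IsSubgame S → Trap P S S
  Trap-refl sub = record
    { subset = λ v∈ → v∈ ; own = λ v∈ _ → sub v∈ ; opponent = λ _ _ w∈S _ → w∈S }

  Trap-trans : Trap P S T → Trap P T X → Trap P S X
  Trap-trans ST TX = record
    { subset   = ST.subset ∘ TX.subset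
    ; own      = TX.own
    ; opponent = λ v∈X o w∈S w∈succ →
        TX.opponent v∈X o (ST.opponent (TX.subset v∈X) o w∈S w∈succ) w∈succ }
    where
    module ST = Trap ST
    module TX = Trap TX

  Trap-shrink : Trap P S T → T ⊆ S′ → S′ ⊆ S → Trap P S′ T
  Trap-shrink tr T⊆S′ S′⊆S = record
    { subset   = T⊆S′
    ; own      = Trap.own tr
    ; opponent = λ v∈T o w∈S′ → Trap.opponent tr v∈T o (S′⊆S w∈S′) }

  -- At its own vertices `Q` moves into `T`, and this move stays in `D` because `D` confines the
  -- opponent of `P`.
  Trap-∩ : P ≢ Q → Trap P S D → Trap Q S T → Trap Q D (D ∩ T)
  Trap-∩ {D = D} {T} P≢Q trD trT = record
    { subset   = p∩q⊆p D T
    ; own      = λ v∈ o → let v∈D , v∈T = x∈p∩q⁻ D T v∈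
                              w , w∈T , w∈succ = T.own v∈T o
                              w∈D = D.opponent v∈D (λ o′ → P≢Q (trans (sym o′) o))
                                      (T.subset w∈T) w∈succ in
                 w , x∈p∩q⁺ (w∈D , w∈T) , w∈succ
    ; opponent = λ v∈ o w∈D w∈succ →
        x∈p∩q⁺ (w∈D , T.opponent (p∩q⊆q D T v∈) o (D.subset w∈D) w∈succ) }
    where
    module D = Trap trD
    module T = Trap trT

  Trap-∩′ : P ≢ Q → Trap P S D → Trap Q S T → Trap P T (D ∩ T)
  Trap-∩′ {P} {D = D} {T} P≢Q trD trT =
    subst (Trap P T) (∩-comm T D) (Trap-∩ (P≢Q ∘ sym) trT trD)

  Trap⇒IsSubgame : IsSubgame S → Trap P S T → IsSubgame T
  Trap⇒IsSubgame {P = P} sub tr {v} v∈T with owner v ℙ.≟ P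
  ... | yes o = Trap.own tr v∈T o
  ... | no  o = let w , w∈S , w∈succ = sub (Trap.subset tr v∈T) in
                w , Trap.opponent tr v∈T o w∈S w∈succ , w∈succ

  -- Attractors.

  data Progress (σ : EdgeSet) (B : Vertices) (v : Vertex) : Set where
    here  : v ∈ B → Progress σ B v
    there : (∀ {w} → w ∈ σ v → Progress σ B w) → Progress σ B v

  Progress-map : (∀ {v w} → v ∈ A → v ∉ B → w ∈ σ v → w ∈ A) →
                 (∀ {v w} → v ∈ A → v ∉ B → w ∈ τ v → w ∈ σ v) →
                 v ∈ A → Progress σ B v → Progress τ B v
  Progress-map closed τ⊆σ v∈A (here v∈B) = here v∈B
  -- The hypotheses are silent on moves from `B`, so a `there` at a vertex of `B` has to become
  -- `here`.
  Progress-map {B = B} {v = v} closed τ⊆σ v∈A (there p) with v ∈? B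
  ... | yes v∈B = here v∈B
  ... | no  v∉B = there λ w∈τ →
    let w∈σ = τ⊆σ v∈A v∉B w∈τ in Progress-map closed τ⊆σ (closed v∈A v∉B w∈σ) (p w∈σ)

  -- Strengthens `CanReach` twice: `progress` replaces the statement about infinite paths by a
  -- well-founded one that allows induction, and the moves cannot leave `A` before meeting `B`, so
  -- they survive a merge with other moves outside `A`.
  record Attraction (P : Player) (S B A : Vertices) : Set where
    field
      {moves}  : EdgeSet
      strategy : IsStrategy 𝓖 P S moves
      target   : B ⊆ A
      subset   : A ⊆ S
      closed   : v ∈ A → v ∉ B → w ∈ moves v → w ∈ A
      progress : v ∈ A → Progress moves B v

  Progress⇒reaches : Progress σ B v → (path : ℕ → Vertex) → path 0 ≡ v →
                     (∀ i → path (suc i) ∈ σ (path i)) → ∃ λ i → path i ∈ B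
  Progress⇒reaches (here v∈B) path refl follows = 0 , v∈B
  Progress⇒reaches (there p) path refl follows =
    let i , ∈B = Progress⇒reaches (p (follows 0)) (path ∘ suc) refl (follows ∘ suc) in suc i , ∈B

  Attraction⇒CanReach : Attraction P S B A → CanReach 𝓖 P S B A
  Attraction⇒CanReach at = moves , record
    { strategy = strategy ; target = target ; subset = subset
    ; reaches  = λ path ∈A follows → Progress⇒reaches (progress ∈A) path refl follows }
    where open Attraction at

  -- Inside T the opponent can keep the play away from B for ever.

  Trap-avoids : P ≢ Q → CanReach 𝓖 P S B A → Trap Q S T → Disjoint T B → Disjoint T A
  Trap-avoids {P} {Q} {S} {B} {A} {T} P≢Q (moves , reach) trap T∩B=∅ {x} x∈T x∈A =
    let i , ∈B = Re.reaches (proj₁ ∘ play) x∈A (λ i → proj₂ (proj₂ (next (play i)))) in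
    T∩B=∅ (proj₂ (play i)) ∈B
    where
    module Re = IsReachabilityStrategy reach
    module St = IsStrategy Re.strategy
    module T = Trap trap

    next : ((v , _) : ∃ (_∈ T)) → ∃ λ w → w ∈ T × w ∈ moves v
    next (v , v∈T) with owner v ℙ.≟ P
    ... | yes o = let w , w∈σ = St.own (T.subset v∈T) o
                      _ , w∈S , w∈succ = St.edges w∈σ in
                  w , T.opponent v∈T (λ o′ → P≢Q (trans (sym o) o′)) w∈S w∈succ , w∈σ
    ... | no  o = let w , w∈T , w∈succ = T.own v∈T (≢⇒≡-opponent P≢Q o) in
                  w , w∈T , St.opponent (T.subset v∈T) o (T.subset w∈T) w∈succ

    play : ℕ → ∃ (_∈ T)
    play zero    = x , x∈T
    play (suc i) = let w , w∈T , _ = next (play i) in w , w∈T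

  module _ (P : Player) {S B : Vertices} (sub : IsSubgame S) where

    Attractable : Vertices → Vertex → Set
    Attractable A v = (owner v ≡ P → Nonempty (successors v ∩ A)) ×
                      (owner v ≢ P → successors v ∩ S ⊆ A)

    attractable? : ∀ A v → Dec (Attractable A v)
    attractable? A v =
      ((owner v ℙ.≟ P) →-dec nonempty? (successors v ∩ A)) ×-dec
      (¬? (owner v ℙ.≟ P) →-dec ((successors v ∩ S) ⊆? A))

    attraction-start : B ⊆ S → Attraction P S B B
    attraction-start B⊆S = record
      { strategy = full-strategy sub
      ; target   = λ v∈B → v∈B
      ; subset   = B⊆S
      ; closed   = λ v∈B v∉B → contradiction v∈B v∉B
      ; progress = here }

    -- The new vertex takes all its edges into `A`. Vertices of `A` keep their moves because
    -- `v ∉ A`, so their progress carries over.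
    attraction-extend : Attraction P S B A → v ∈ S → v ∉ A → Attractable A v →
                        Attraction P S B (⁅ v ⁆ ∪ A)
    attraction-extend {A} {v} at v∈S v∉A (own , opp) = record
      { strategy = merge-strategy
          (λ {u} u∈ → subst (λ u → StrategyAt P S u (successors v ∩ A)) (sym (x∈⁅y⁆⇒x≡y v u∈)) at-v)
          (λ _ → strategyAt strategy)
      ; target   = q⊆p∪q ⁅ v ⁆ A ∘ target
      ; subset   = λ u∈ → [ (λ u∈v → subst (_∈ S) (sym (x∈⁅y⁆⇒x≡y v u∈v)) v∈S) , subset ]′
                          (x∈p∪q⁻ ⁅ v ⁆ A u∈)
      ; closed   = λ u∈ u∉B w∈ → q⊆p∪q ⁅ v ⁆ A (closed′ (x∈p∪q⁻ ⁅ v ⁆ A u∈) u∉B w∈)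
      ; progress = λ u∈ → progress′ (x∈p∪q⁻ ⁅ v ⁆ A u∈) }
      where
      open Attraction at
      to-A moves′ : EdgeSet
      to-A _ = successors v ∩ A
      moves′ = merge ⁅ v ⁆ to-A moves

      at-v : StrategyAt P S v (successors v ∩ A)
      at-v = record
        { edges    = λ w∈ → let w∈succ , w∈A = x∈p∩q⁻ (successors v) A w∈ in v∈S , subset w∈A , w∈succ
        ; own      = λ _ → own
        ; opponent = λ _ o w∈S w∈succ → x∈p∩q⁺ (w∈succ , opp o (x∈p∩q⁺ (w∈succ , w∈S))) }

      moves′-new : u ∈ ⁅ v ⁆ → w ∈ moves′ u → w ∈ A
      moves′-new {w = w} u∈ w∈ = p∩q⊆q (successors v) A (subst (w ∈_) (merge-∈ to-A moves u∈) w∈)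

      moves′-old : u ∈ A → w ∈ moves′ u → w ∈ moves u
      moves′-old {w = w} u∈A w∈ = subst (w ∈_)
        (merge-∉ to-A moves λ u∈v → v∉A (subst (_∈ A) (x∈⁅y⁆⇒x≡y v u∈v) u∈A)) w∈

      closed′ : u ∈ ⁅ v ⁆ ⊎ u ∈ A → u ∉ B → w ∈ moves′ u → w ∈ A
      closed′ (inj₁ u∈v) u∉B w∈ = moves′-new u∈v w∈
      closed′ (inj₂ u∈A) u∉B w∈ = closed u∈A u∉B (moves′-old u∈A w∈)

      progress-A : u ∈ A → Progress moves′ B u
      progress-A u∈A = Progress-map closed (λ u∈A _ → moves′-old u∈A) u∈A (progress u∈A)

      progress′ : u ∈ ⁅ v ⁆ ⊎ u ∈ A → Progress moves′ B u
      progress′ (inj₁ u∈v) = there λ w∈ → progress-A (moves′-new u∈v w∈)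
      progress′ (inj₂ u∈A) = progress-A u∈A

    -- Attractable vertices are added until none is left. Then, within `S`, a remaining vertex of
    -- `P` has no edge into `A` and one of the opponent has an edge avoiding `A`, so the opponent
    -- can stay in `S ─ A`.
    attraction-grow : Acc _⊃_ A → Attraction P S B A →
                      ∃ λ A → Attraction P S B A × Trap (P ⁻¹) S (S ─ A)
    attraction-grow {A} (acc rec) at
      with any? (λ v → (v ∈? S) ×-dec (¬? (v ∈? A) ×-dec attractable? A v))
    ... | yes (v , v∈S , v∉A , attr) =
      attraction-grow (rec (q⊆p∪q ⁅ v ⁆ A , v , p⊆p∪q A (x∈⁅x⁆ v) , v∉A))
                      (attraction-extend at v∈S v∉A attr)
    ... | no none = A , at , record
      { subset   = p─q⊆p S A
      ; own      = own′
      ; opponent = λ {v} v∈ o w∈S w∈succ → x∈p∧x∉q⇒x∈p─q w∈S λ w∈A →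
          stuck v∈ ( (λ _ → _ , x∈p∩q⁺ (w∈succ , w∈A))
                   , (λ o′ → contradiction (≢⇒≡-opponent p≢p⁻¹ o′) o)) }
      where
      stuck : v ∈ S ─ A → ¬ Attractable A v
      stuck {v} v∈ attr = none (v , p─q⊆p S A v∈ , x∈p─q⇒x∉q S A v∈ , attr)

      own′ : v ∈ S ─ A → owner v ≡ P ⁻¹ → ∃ λ w → w ∈ S ─ A × w ∈ successors v
      own′ {v} v∈ o with nonempty? (successors v ∩ (S ─ A))
      ... | yes (w , w∈) = let w∈succ , w∈S─A = x∈p∩q⁻ (successors v) (S ─ A) w∈ in w , w∈S─A , w∈succ
      ... | no empty = contradiction
        ( (λ o′ → contradiction (trans (sym o′) o) p≢p⁻¹)
        , (λ _ {x} x∈ → let x∈succ , x∈S = x∈p∩q⁻ (successors v) S x∈ in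
             x∉p─q⇒x∈q x∈S λ x∈S─A → empty (x , x∈p∩q⁺ (x∈succ , x∈S─A))))
        (stuck v∈)

    attraction : B ⊆ S → ∃ λ A → Attraction P S B A × Trap (P ⁻¹) S (S ─ A)
    attraction B⊆S = attraction-grow (⊃-wellFounded B) (attraction-start B⊆S)

  -- The trap `S ─ A` certifies maximality: from any of its vertices the opponent avoids `B` for
  -- ever.
  attraction-maximal : Attraction P S B A → Trap (P ⁻¹) S (S ─ A) → IsAttractor 𝓖 P S B A
  attraction-maximal {S = S} {A = A} at trap = Attraction⇒CanReach at , λ A′ reach@(_ , r) {x} x∈A′ →
    x∉p─q⇒x∈q (IsReachabilityStrategy.subset r x∈A′) λ x∈S─A →
    Trap-avoids p≢p⁻¹ reach trap (λ y∈ y∈B → x∈p─q⇒x∉q S A y∈ (Attraction.target at y∈B)) x∈S─A x∈A′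

  attractor : ∀ P → IsSubgame S → B ⊆ S → ∃ λ A → IsAttractor 𝓖 P S B A
  attractor P sub B⊆S = let A , at , trap = attraction P sub B⊆S in A , attraction-maximal at trap

  attractor-unique : IsAttractor 𝓖 P S B A → IsAttractor 𝓖 P S B A′ → A ≡ A′
  attractor-unique (reach , max) (reach′ , max′) = ⊆-antisym (max′ _ reach) (max _ reach′)

  attractor-target : IsAttractor 𝓖 P S B A → B ⊆ A
  attractor-target ((_ , r) , _) = IsReachabilityStrategy.target r

  attractor-subset : IsAttractor 𝓖 P S B A → A ⊆ S
  attractor-subset ((_ , r) , _) = IsReachabilityStrategy.subset r

  -- An attractor is known only through its maximality, but by uniqueness it is the constructed one,
  -- whose complement is a trap.
  attractor-complement : IsSubgame S → IsAttractor 𝓖 P S B A → Trap (P ⁻¹) S (S ─ A)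
  attractor-complement {S} {P} sub att =
    let A′ , at , trap = attraction P sub (attractor-subset att ∘ attractor-target att) in
    subst (λ A → Trap (P ⁻¹) S (S ─ A)) (attractor-unique (attraction-maximal at trap) att) trap

  -- A vertex of `A` outside `A′` would lie in `D ∩ (S ─ A′)`, where the opponent can stay within
  -- `D` and never meet `B`.
  attractor-mono : IsSubgame S → Trap P S D → B ⊆ X →
                   IsAttractor 𝓖 P D B A → IsAttractor 𝓖 P S X A′ → A ⊆ A′
  attractor-mono {S} {P} {D} {A′ = A′} sub trap B⊆X attD attS {x} x∈A with x ∈? A′
  ... | yes x∈A′ = x∈A′
  ... | no  x∉A′ = contradiction x∈A
    (Trap-avoids p≢p⁻¹ (proj₁ attD) (Trap-∩ p≢p⁻¹ trap (attractor-complement sub attS))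
      (λ y∈ y∈B → x∈p─q⇒x∉q S A′ (p∩q⊆q D (S ─ A′) y∈) (attractor-target attS (B⊆X y∈B)))
      (x∈p∩q⁺ (x∈D , x∈p∧x∉q⇒x∈p─q (Trap.subset trap x∈D) x∉A′)))
    where
    x∈D : x ∈ D
    x∈D = attractor-subset attD x∈A

  -- In `S` the set `X ─ A′` is a trap disjoint from `B`, hence disjoint from the attractor `A` as
  -- well.
  residue-trap : IsSubgame S → Trap (P ⁻¹) S X → B ∩ X ⊆ D →
                 IsAttractor 𝓖 P S B A → IsAttractor 𝓖 P X D A′ → Trap (P ⁻¹) (S ─ A) (X ─ A′)
  residue-trap {S} {P} {X} {B} {D} {A} {A′} sub trap B∩X⊆D attS attX =
    Trap-shrink in-S
      (λ x∈ → x∈p∧x∉q⇒x∈p─q (Trap.subset in-S x∈)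
        (Trap-avoids p≢p⁻¹ (proj₁ attS) in-S
          (λ y∈ y∈B → x∈p─q⇒x∉q X A′ y∈
            (attractor-target attX (B∩X⊆D (x∈p∩q⁺ (y∈B , p─q⊆p X A′ y∈))))) x∈))
      (p─q⊆p S A)
    where
    in-S : Trap (P ⁻¹) S (X ─ A′)
    in-S = Trap-trans trap (attractor-complement (Trap⇒IsSubgame sub trap) attX)

  complement-subgame : IsSubgame S → IsAttractor 𝓖 P S B A → IsSubgame (S ─ A)
  complement-subgame sub att = Trap⇒IsSubgame sub (attractor-complement sub att)

  IsTrapFor⇒Trap : IsTrapFor 𝓖 (P ⁻¹) S T → Trap P S T
  IsTrapFor⇒Trap {P} {S} {T} (_ , tr) =
    subst (λ P → Trap P S T) (ℙ.⁻¹-involutive P) (Traps⇒Trap tr)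

  Trap⇒IsTrapFor : IsSubgame S → Trap P S T → IsTrapFor 𝓖 (P ⁻¹) S T
  Trap⇒IsTrapFor {S} {P} {T} sub tr =
    Trap⇒Traps sub (subst (λ P → Trap P S T) (sym (ℙ.⁻¹-involutive P)) tr)

  -- Restricting decompositions to traps.

  mutual
    -- All sets are intersected with `X` and the attractors recomputed there; `residue-trap` carries
    -- the trap through each removal. Components that become empty are dropped, which is why the
    -- tree is embedded rather than equal.
    restrict : ∀ {e} → IsSubgame S → Trap (P ⁻¹) S X → (𝓗 : Decomposition 𝓖 P e S) →
               ∃ λ (𝓗′ : Decomposition 𝓖 P e X) → tree 𝓖 𝓗 Embeds tree 𝓖 𝓗′
    restrict {P = P} {X} {e} sub trap (decomposition A parity-e bound att cs) =
      let A′ , att′ = attractor P (Trap⇒IsSubgame sub trap) (p∩q⊆q (π⁻¹ (+ e)) X)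
          cs′ , cs′⊑cs = restrict* (complement-subgame sub att)
            (residue-trap sub trap
              (λ x∈ → let x∈B , x∈X = x∈p∩q⁻ _ X x∈ in x∈p∩q⁺ (p∩q⊆p _ _ x∈B , x∈X)) att att′) cs in
      decomposition A′ parity-e (λ v∈X → bound (Trap.subset trap v∈X)) att′ cs′ , ⟨ cs′⊑cs ⟩

    restrict* : ∀ {e} → IsSubgame S → Trap (P ⁻¹) S X → (cs : Components 𝓖 P e S) →
                ∃ λ (cs′ : Components 𝓖 P e X) → trees 𝓖 cs′ ⊑ trees 𝓖 cs
    restrict* sub trap ([] S-empty) = [] (λ (x , x∈X) → S-empty (x , Trap.subset trap x∈X)) , []
    restrict* {P = P} {X} sub trap (add S₁ A₁ ne trap₁ 𝓗₁ att cs) with nonempty? (S₁ ∩ X)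
    ... | yes ne′ =
      let sub-X = Trap⇒IsSubgame sub trap
          tr₁ = IsTrapFor⇒Trap trap₁
          𝓗₁′ , 𝓗₁⊒𝓗₁′ = restrict (Trap⇒IsSubgame sub tr₁) (Trap-∩ p≢p⁻¹ tr₁ trap) 𝓗₁
          A₁′ , att′ = attractor P sub-X (p∩q⊆q S₁ X)
          cs′ , cs′⊑cs = restrict* (complement-subgame sub att)
                           (residue-trap sub trap (λ x∈ → x∈) att att′) cs in
      add (S₁ ∩ X) A₁′ ne′ (Trap⇒IsTrapFor sub-X (Trap-∩′ p≢p⁻¹ tr₁ trap)) 𝓗₁′ att′ cs′ ,
      𝓗₁⊒𝓗₁′ ∷ cs′⊑cs
    -- If `X` misses `S₁`, the opponent avoids `S₁` by staying in `X`, so `X` misses `A₁` too and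
    -- survives its removal unchanged.
    ... | no S₁∩X=∅ =
      let cs′ , cs′⊑cs = restrict* (complement-subgame sub att)
            (Trap-shrink trap
              (λ x∈X → x∈p∧x∉q⇒x∈p─q (Trap.subset trap x∈X)
                (Trap-avoids p≢p⁻¹ (proj₁ att) trap
                  (λ {y} y∈X y∈S₁ → S₁∩X=∅ (y , x∈p∩q⁺ (y∈S₁ , y∈X))) x∈X))
              (p─q⊆p _ A₁)) cs in
      cs′ , tree 𝓖 𝓗₁ ∷ʳ cs′⊑cs

  -- Priority bounds.

  Bounded : ℕ → Vertices → Set
  Bounded d S = ∀ {v} → v ∈ S → π v ≤ d

  decomposition-bounded : ∀ {e} → Decomposition 𝓖 P e S → Bounded e S
  decomposition-bounded (decomposition _ _ bound _ _) = bound

  top⊆attractor : ∀ {d} → IsAttractor 𝓖 P S (π⁻¹ (+ d) ∩ S) A → v ∈ S → π v ≡ d → v ∈ A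
  top⊆attractor att v∈S πv≡d = attractor-target att (x∈p∩q⁺ (∈π⁻¹⁺ πv≡d , v∈S))

  below-top : ∀ {d} → Bounded (suc d) S → IsAttractor 𝓖 P S (π⁻¹ (+ suc d) ∩ S) A → Bounded d (S ─ A)
  below-top {S} {A = A} bound att v∈ = s≤s⁻¹ (ℕ.≤∧≢⇒< (bound (p─q⊆p S A v∈))
    λ πv≡d → x∈p─q⇒x∉q S A v∈ (top⊆attractor att (p─q⊆p S A v∈) πv≡d))

  top-avoids : ∀ {d e} → Bounded e T → e < d → Disjoint T (π⁻¹ (+ d) ∩ S)
  top-avoids bound e<d x∈T x∈ =
    ℕ.<⇒≢ (ℕ.≤-<-trans (bound x∈T) e<d) (∈π⁻¹⁻ (p∩q⊆p _ _ x∈))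

  below-zero : Bounded 0 S → IsAttractor 𝓖 P S (π⁻¹ (+ 0) ∩ S) A → Empty (S ─ A)
  below-zero {S} {A = A} bound att (v , v∈) = x∈p─q⇒x∉q S A v∈
    (top⊆attractor att v∈S (ℕ.n≤0⇒n≡0 (bound v∈S)))
    where
    v∈S : v ∈ S
    v∈S = p─q⊆p S A v∈

  -- Existence and uniqueness of the result of a run.

  private
    variable
      U U′ : Vertices
      z : ℤ
      t t′ : Tree
      ts : List Tree

  loop-subset : Loop 𝓖 P S z t ts U → U ⊆ S
  loop-subset done           = λ v∈ → v∈
  loop-subset (step _ _ _ l) = p─q⊆p _ _ ∘ loop-subset l

  univ-subset : Univ 𝓖 P S z t t′ U → U ⊆ S
  univ-subset (run l) = loop-subset l

  mutual
    -- The recursion is on the trees: a call swaps them and replaces the opponent's by a proper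
    -- subtree. Hence it stops even though the priority may become negative.
    univ-exists : IsSubgame S → ∀ P z t t′ → ∃ λ U → Univ 𝓖 P S z t t′ U
    univ-exists sub P z t ⟨ ts ⟩ = let U , l = loop-exists sub P z t ts in U , run l

    loop-exists : IsSubgame S → ∀ P z t ts → ∃ λ U → Loop 𝓖 P S z t ts U
    loop-exists sub P z t [] = _ , done
    loop-exists sub P z t (t₁ ∷ ts) =
      let A , att   = attractor P sub (p∩q⊆q (π⁻¹ z) _)
          U₁ , univ = univ-exists (complement-subgame sub att) (P ⁻¹) (z - 1ℤ) t₁ t
          A′ , att′ = attractor (P ⁻¹) sub (p─q⊆p _ A ∘ univ-subset univ)
          U , l     = loop-exists (complement-subgame sub att′) P z t ts in
      U , step att univ att′ l

  mutual
    univ-unique : Univ 𝓖 P S z t t′ U → Univ 𝓖 P S z t t′ U′ → U ≡ U′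
    univ-unique (run l) (run l′) = loop-unique l l′

    loop-unique : Loop 𝓖 P S z t ts U → Loop 𝓖 P S z t ts U′ → U ≡ U′
    loop-unique done done = refl
    loop-unique (step att₁ univ₁ att₁′ l₁) (step att₂ univ₂ att₂′ l₂)
      with refl ← attractor-unique att₁ att₂
      with refl ← univ-unique univ₁ univ₂
      with refl ← attractor-unique att₁′ att₂′ = loop-unique l₁ l₂

  -- What a run captures and what it excludes.

  mutual
    -- A dominion is represented by a trap with a decomposition, a form that is inherited by what
    -- the loop and the recursive calls leave of it.
    univ-captures : ∀ {d} → IsSubgame S → Bounded d S → Univ 𝓖 P S (+ d) t t′ U →
                    Trap P S D → (𝓗 : Decomposition 𝓖 P d D) → t Embeds tree 𝓖 𝓗 → D ⊆ U
    univ-captures sub bound (run l) = loop-captures sub bound l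

    -- The recursive call returns nothing of `D`, so the opponent's attractor to its result misses
    -- the trap `D`, which enters the next iteration with the same decomposition.
    loop-captures : ∀ {d} → IsSubgame S → Bounded d S → Loop 𝓖 P S (+ d) t ts U →
                    Trap P S D → (𝓗 : Decomposition 𝓖 P d D) → t Embeds tree 𝓖 𝓗 → D ⊆ U
    loop-captures sub bound done trap 𝓗 emb = Trap.subset trap
    loop-captures {S} {P} {t} {D = D} {d} sub bound
                  (step {t₁} {A = A} {U₁} {A′} att univ att′ l) trap 𝓗 emb =
      loop-captures (complement-subgame sub att′) (bound ∘ p─q⊆p S A′) l
        (Trap-shrink trap
          (λ x∈D → x∈p∧x∉q⇒x∈p─q (Trap.subset trap x∈D)
            (Trap-avoids (p≢p⁻¹ ∘ sym) (proj₁ att′) trap (D∩U₁=∅ d bound univ att 𝓗 emb) x∈D))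
          (p─q⊆p S A′))
        𝓗 emb
      where
      D∩U₁=∅ : ∀ d → Bounded d S → Univ 𝓖 (P ⁻¹) (S ─ A) (+ d - 1ℤ) t₁ t U₁ →
               IsAttractor 𝓖 P S (π⁻¹ (+ d) ∩ S) A →
               (𝓗 : Decomposition 𝓖 P d D) → t Embeds tree 𝓖 𝓗 → Disjoint D U₁
      -- The recursive call has priority -1 here, but all of `S` has priority 0, so it runs on the
      -- empty game.
      D∩U₁=∅ zero bound univ att _ _ _ x∈U₁ = below-zero bound att (_ , univ-subset univ x∈U₁)
      -- The level `suc e` of the decomposition is one above the priority `e` of the recursive call,
      -- as `univ-excludes` demands.
      D∩U₁=∅ (suc e) bound univ att 𝓗 emb {x} x∈D x∈U₁ =
        let co        = attractor-complement sub att
            𝓗′ , emb′ = restrict (Trap⇒IsSubgame sub trap) (Trap-∩ p≢p⁻¹ trap co) 𝓗 in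
        univ-excludes (complement-subgame sub att) (below-top bound att) univ
          (sym (ℙ.⁻¹-involutive P)) (Trap-∩′ p≢p⁻¹ trap co) 𝓗′ (Embeds-trans emb emb′)
          (x∈p∩q⁺ (x∈D , univ-subset univ x∈U₁)) x∈U₁

    -- No vertex has priority `suc d`, so the leading attractor `A` is empty and the components
    -- decompose all of `D`. The equation `Q ≡ P ⁻¹` lets a recursive call use `P` itself where
    -- `P ⁻¹ ⁻¹` would appear.
    univ-excludes : ∀ {d} → IsSubgame S → Bounded d S → Univ 𝓖 P S (+ d) t t′ U → Q ≡ P ⁻¹ →
                    Trap Q S D → (𝓗 : Decomposition 𝓖 Q (suc d) D) →
                    t′ Embeds tree 𝓖 𝓗 → Disjoint D U
    univ-excludes {S} {D = D} {d} sub bound (run l) refl trap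
                  (decomposition A _ _ att cs) ⟨ cs⊑ts ⟩ x∈D =
      loop-excludes sub bound l (subst (Trap _ S) (sym D─A≡D) trap) cs cs⊑ts
        (subst (_ ∈_) (sym D─A≡D) x∈D)
      where
      D─A≡D : D ─ A ≡ D
      D─A≡D = ⊆-antisym (p─q⊆p D A) λ x∈D → x∈p∧x∉q⇒x∈p─q x∈D
        (Trap-avoids p≢p⁻¹ (proj₁ att) (Trap-refl (Trap⇒IsSubgame sub trap))
          (top-avoids (bound ∘ Trap.subset trap) ℕ.≤-refl) x∈D)

    loop-excludes : ∀ {d} → IsSubgame S → Bounded d S → Loop 𝓖 P S (+ d) t ts U →
                    Trap (P ⁻¹) S D → (cs : Components 𝓖 (P ⁻¹) (suc d) D) →
                    trees 𝓖 cs ⊑ ts → Disjoint D U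
    loop-excludes sub bound l trap ([] D-empty) _ x∈D _ = D-empty (_ , x∈D)
    -- This iteration uses a tree that matches no component. It may still remove part of `D`, so the
    -- components are restricted to the rest.
    loop-excludes {S} {D = D} sub bound (step {A′ = A′} att univ att′ l) trap
                  cs@(add _ _ _ _ _ _ _) (_ ∷ʳ cs⊑ts) x∈D x∈U =
      let co        = attractor-complement sub att′
          cs′ , cs′⊑cs = restrict* (Trap⇒IsSubgame sub trap) (Trap-∩ p≢p⁻¹ trap co) cs in
      loop-excludes (complement-subgame sub att′) (bound ∘ p─q⊆p S A′) l
        (Trap-∩′ p≢p⁻¹ trap co) cs′ (⊑-trans cs′⊑cs cs⊑ts)
        (x∈p∩q⁺ (x∈D , loop-subset l x∈U)) x∈U
    -- The tree matches the first component, whose level `e` is the priority of the recursive call.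
    -- As `S₁ ⊆ U₁`, monotonicity puts `A₁` inside `A′`, so what is left of `D` lies in `D ─ A₁` and
    -- the remaining components restrict to it.
    loop-excludes {S} {P} {D = D} {suc e} sub bound (step {A = A} {U₁} {A′} att univ att′ l) trap
                  (add S₁ A₁ _ trap₁ 𝓗₁ att₁ cs) (emb ∷ cs⊑ts) x∈D x∈U =
      let co        = attractor-complement sub att′
          cs′ , cs′⊑cs = restrict* (complement-subgame (Trap⇒IsSubgame sub trap) att₁)
            (Trap-shrink (Trap-∩ p≢p⁻¹ trap co)
              (λ y∈ → let y∈D , y∈S─A′ = x∈p∩q⁻ D (S ─ A′) y∈ in
                x∈p∧x∉q⇒x∈p─q y∈D (x∈p─q⇒x∉q S A′ y∈S─A′ ∘ attractor-mono sub trap S₁⊆U₁ att₁ att′))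
              (p─q⊆p D A₁)) cs in
      loop-excludes (complement-subgame sub att′) (bound ∘ p─q⊆p S A′) l
        (Trap-∩′ p≢p⁻¹ trap co) cs′ (⊑-trans cs′⊑cs cs⊑ts)
        (x∈p∩q⁺ (x∈D , loop-subset l x∈U)) x∈U
      where
      S₁-trap : Trap (P ⁻¹) S S₁
      S₁-trap = Trap-trans trap (IsTrapFor⇒Trap trap₁)

      -- Priorities in the trap `S₁` are too low to meet the target of `A`, so `S₁` lies wholly in
      -- the game of the recursive call.
      S₁⊆U₁ : S₁ ⊆ U₁
      S₁⊆U₁ = univ-captures (complement-subgame sub att) (below-top bound att) univ
        (Trap-shrink S₁-trap
          (λ x∈S₁ → x∈p∧x∉q⇒x∈p─q (Trap.subset S₁-trap x∈S₁)
            (Trap-avoids p≢p⁻¹ (proj₁ att) S₁-trap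
              (top-avoids (decomposition-bounded 𝓗₁) ℕ.≤-refl) x∈S₁))
          (p─q⊆p S A))
        𝓗₁ emb

  -- Cycles and their highest priorities.

  Restriction : EdgeSet → Vertices → Vertex → Vertex → Set
  Restriction = Restrict 𝓖

  highest-++ : ∀ {_~_ : Vertex → Vertex → Set}
               (c : TransClosure _~_ u v) (c′ : TransClosure _~_ v w) →
               highest 𝓖 (c ++ c′) ≡ highest 𝓖 c ⊔ highest 𝓖 c′
  highest-++ [ _ ]       c′ = refl
  highest-++ (_∷_ {u} _ c) c′ = trans (cong (π u ⊔_) (highest-++ c c′)) (sym (ℕ.⊔-assoc (π u) _ _))

  highest-rotate : ∀ {_~_ : Vertex → Vertex → Set}
                   (c : TransClosure _~_ u v) (c′ : TransClosure _~_ v u) →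
                   highest 𝓖 (c ++ c′) ≡ highest 𝓖 (c′ ++ c)
  highest-rotate c c′ = trans (highest-++ c c′)
    (trans (ℕ.⊔-comm (highest 𝓖 c) (highest 𝓖 c′)) (sym (highest-++ c′ c)))

  highest-start : ∀ {_~_ : Vertex → Vertex → Set} (c : TransClosure _~_ v w) → π v ≤ highest 𝓖 c
  highest-start [ _ ]         = ℕ.≤-refl
  highest-start (_∷_ {v} _ c) = ℕ.m≤m⊔n (π v) _

  highest-bounded : ∀ {d} → Bounded d D → (c : TransClosure (Restriction σ D) v w) → highest 𝓖 c ≤ d
  highest-bounded bound [ v∈D , _ ]       = bound v∈D
  highest-bounded bound ((v∈D , _) ∷ c) = ℕ.⊔-lub (bound v∈D) (highest-bounded bound c)

  -- Carries a cycle from one strategy to another that agrees with it along the walk; `X` is an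
  -- invariant of the vertices visited.
  transfer : ∀ {_~_ _≈_ : Vertex → Vertex → Set} X →
             (∀ {v w} → v ∈ X → v ~ w → v ≈ w × w ∈ X) → v ∈ X →
             (c : TransClosure _~_ v w) → ∃ λ (c′ : TransClosure _≈_ v w) → highest 𝓖 c′ ≡ highest 𝓖 c
  transfer X f v∈X [ r ]         = [ proj₁ (f v∈X r) ] , refl
  transfer X f v∈X (_∷_ {v} r c) =
    let r′ , w∈X = f v∈X r
        c′ , eq  = transfer X f w∈X c in r′ ∷ c′ , cong (π v ⊔_) eq

  -- The walk is split at its first visit to `X`, so that a cycle can be rotated to start there.
  avoid-or-meet : ∀ X → v ∉ X → w ∉ X → (c : TransClosure (Restriction σ D) v w) →
    (∃ λ (c′ : TransClosure (Restriction σ (D ─ X)) v w) → highest 𝓖 c′ ≡ highest 𝓖 c) ⊎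
    (∃ λ u → u ∈ X × ∃ λ (c₁ : TransClosure (Restriction σ D) v u) → ∃ λ c₂ → c ≡ c₁ ++ c₂)
  avoid-or-meet X v∉X w∉X [ v∈D , w∈D , w∈σ ] =
    inj₁ ([ x∈p∧x∉q⇒x∈p─q v∈D v∉X , x∈p∧x∉q⇒x∈p─q w∈D w∉X , w∈σ ] , refl)
  avoid-or-meet X v∉X w∉X (_∷_ {v} {u} r@(v∈D , u∈D , u∈σ) c) with u ∈? X
  ... | yes u∈X = inj₂ (u , u∈X , [ r ] , c , refl)
  ... | no  u∉X with avoid-or-meet X u∉X w∉X c
  ...   | inj₁ (c′ , eq) =
    inj₁ ((x∈p∧x∉q⇒x∈p─q v∈D v∉X , x∈p∧x∉q⇒x∈p─q u∈D u∉X , u∈σ) ∷ c′ , cong (π v ⊔_) eq)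
  ...   | inj₂ (x , x∈X , c₁ , c₂ , refl) = inj₂ (x , x∈X , r ∷ c₁ , c₂ , refl)

  cycle-avoids-or-meets : ∀ X → (c : TransClosure (Restriction σ D) v v) →
    (∃ λ (c′ : TransClosure (Restriction σ (D ─ X)) v v) → highest 𝓖 c′ ≡ highest 𝓖 c) ⊎
    (∃ λ u → u ∈ X × ∃ λ (c′ : TransClosure (Restriction σ D) u u) → highest 𝓖 c′ ≡ highest 𝓖 c)
  cycle-avoids-or-meets {v = v} X c with v ∈? X
  ... | yes v∈X = inj₂ (v , v∈X , c , refl)
  ... | no  v∉X with avoid-or-meet X v∉X v∉X c
  ...   | inj₁ avoiding = inj₁ avoiding
  ...   | inj₂ (u , u∈X , c₁ , c₂ , refl) = inj₂ (u , u∈X , c₂ ++ c₁ , highest-rotate c₂ c₁)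

  -- The cycle is rotated by one edge at a time; well-foundedness of `Progress` stops this at a
  -- vertex of `B`.
  Progress⇒cycle-meets : Progress σ B v → (c : TransClosure (Restriction σ D) v v) →
    ∃ λ u → u ∈ B × ∃ λ (c′ : TransClosure (Restriction σ D) u u) → highest 𝓖 c′ ≡ highest 𝓖 c
  Progress⇒cycle-meets {v = v} (here v∈B) c = v , v∈B , c , refl
  Progress⇒cycle-meets (there p) c@([ _ , _ , v∈σ ]) = Progress⇒cycle-meets (p v∈σ) c
  Progress⇒cycle-meets (there p) (r@(_ , _ , w∈σ) ∷ c) =
    let u , u∈B , c′ , eq = Progress⇒cycle-meets (p w∈σ) (c ++ [ r ]) in
    u , u∈B , c′ , trans eq (highest-rotate c [ r ])

  -- A cycle that meets `A` also meets `B`, and rotating it to start there keeps its highest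
  -- priority.
  cycles-good : (∀ {v} → v ∈ A → Progress σ B v) →
                (∀ {v} → v ∈ B → (c : TransClosure (Restriction σ D) v v) → parity (highest 𝓖 c) ≡ P) →
                AllCyclesGood 𝓖 P σ (D ─ A) → AllCyclesGood 𝓖 P σ D
  cycles-good {A} progress good-B good-rest c with cycle-avoids-or-meets A c
  ... | inj₁ (c′ , eq) = trans (cong parity (sym eq)) (good-rest c′)
  ... | inj₂ (u , u∈A , c′ , eq) =
    let _ , v∈B , c″ , eq′ = Progress⇒cycle-meets (progress u∈A) c′ in
    trans (cong parity (sym (trans eq′ eq))) (good-B v∈B c″)

  -- Extending and combining dominia.

  owned : Player → Vertices
  owned P = tabulate λ v → does (owner v ℙ.≟ P)

  ∈owned⁺ : owner v ≡ P → v ∈ owned P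
  ∈owned⁺ {v} {P} o = lookup⇒[]= v _ (trans (lookup∘tabulate _ v) (dec-true (owner v ℙ.≟ P) o))

  ∈owned⁻ : v ∈ owned P → owner v ≡ P
  ∈owned⁻ {v} {P} v∈ = does-true⇒ (owner v ℙ.≟ P) (trans (sym (lookup∘tabulate _ v)) ([]=⇒lookup v∈))

  -- Only the vertices of `P` in `S′` keep `σ`. An opponent's vertex must be given all its edges in
  -- `S`, so the only new moves from `S′` are the opponent's moves out of it.
  extend : IsSubgame S → S′ ⊆ S → IsStrategy 𝓖 P S′ σ → ∃ λ τ → IsStrategy 𝓖 P S τ ×
           (∀ {v w} → v ∈ S′ → w ∈ τ v → w ∈ σ v ⊎ (w ∉ S′ × owner v ≢ P))
  extend {S} {S′} {P} {σ} sub S′⊆S st = merge own-S′ σ (full S) , merge-strategy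
      (λ v∈ → let v∈S′ , v∈own = x∈p∩q⁻ S′ (owned P) v∈ in record
        { edges    = λ w∈ → let _ , w∈S′ , w∈succ = St.edges w∈ in S′⊆S v∈S′ , S′⊆S w∈S′ , w∈succ
        ; own      = λ _ → St.own v∈S′
        ; opponent = λ _ o → contradiction (∈owned⁻ v∈own) o })
      (λ _ → strategyAt full-st) ,
    new-moves
    where
    module St = IsStrategy st
    full-st : IsStrategy 𝓖 P S (full S)
    full-st = full-strategy sub
    own-S′ : Vertices
    own-S′ = S′ ∩ owned P

    new-moves : v ∈ S′ → w ∈ merge own-S′ σ (full S) v → w ∈ σ v ⊎ (w ∉ S′ × owner v ≢ P)
    new-moves {v} {w} v∈S′ w∈ with owner v ℙ.≟ P
    ... | yes o = inj₁ (subst (w ∈_) (merge-∈ σ (full S) (x∈p∩q⁺ (v∈S′ , ∈owned⁺ o))) w∈)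
    ... | no  o with w ∈? S′
    ...   | no  w∉S′ = inj₂ (w∉S′ , o)
    ...   | yes w∈S′ = inj₁ (St.opponent v∈S′ o w∈S′ (proj₂ (proj₂ (IsStrategy.edges full-st
      (subst (w ∈_) (merge-∉ σ (full S) (λ v∈ → o (∈owned⁻ (p∩q⊆q S′ (owned P) v∈)))) w∈)))))

  -- The opponent cannot leave the trap `S′`, so the extended strategy has no new moves from `D` and
  -- no new cycles in it.
  dominion-lift : IsSubgame S → Trap P S S′ → IsDominion 𝓖 P S′ D → IsDominion 𝓖 P S D
  dominion-lift {S} {P} {S′} {D} sub trap (σ , traps , good)
    with extend sub (Trap.subset trap) (Traps.strategy traps)
  ... | τ , τ-strategy , τ-moves = τ ,
    record { strategy = τ-strategy
           ; subset   = Trap.subset trap ∘ D.subset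
           ; closed   = λ w∈D u∈τ → D.closed w∈D (τ⊆σ w∈D u∈τ) } ,
    λ c → let c′ , eq = transfer D (λ v∈D (_ , w∈D , w∈τ) → (v∈D , w∈D , τ⊆σ v∈D w∈τ) , w∈D)
                          (start c) c in
          trans (cong parity (sym eq)) (good c′)
    where
    module D = Traps traps

    τ⊆σ : v ∈ D → w ∈ τ v → w ∈ σ v
    τ⊆σ v∈D w∈τ with τ-moves (D.subset v∈D) w∈τ
    ... | inj₁ w∈σ = w∈σ
    ... | inj₂ (w∉S′ , o) = let _ , w∈S , w∈succ = IsStrategy.edges τ-strategy w∈τ in
      contradiction (Trap.opponent trap (D.subset v∈D) o w∈S w∈succ) w∉S′

    start : TransClosure (Restriction τ D) v w → v ∈ D
    start [ v∈D , _ ]     = v∈D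
    start ((v∈D , _) ∷ _) = v∈D

  -- Play follows `τ` on `B`, the attraction on the rest of `A`, and `σ` elsewhere. Cycles meeting
  -- `A` pass through `B`; the others are cycles of the dominion `D`. The last hypothesis ranges
  -- over all strategies agreeing with `τ` on `B` because the merged one is built only in the proof.
  dominion-attract :
    IsSubgame S → Attraction P S B A → IsDominion 𝓖 P (S ─ A) D → IsStrategy 𝓖 P S τ →
    (∀ {v w} → v ∈ B → w ∈ τ v → w ∈ A ∪ D) →
    (∀ {σ} → (∀ {v} → v ∈ B → σ v ≡ τ v) →
       ∀ {v} → v ∈ B → (c : TransClosure (Restriction σ (A ∪ D)) v v) → parity (highest 𝓖 c) ≡ P) →
    IsDominion 𝓖 P S (A ∪ D)
  dominion-attract {S} {P} {B} {A} {D} {τ} sub at (σ , traps , good) τ-strategy τ-closed τ-good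
    with extend sub (p─q⊆p S A) (Traps.strategy traps)
  ... | σ′ , σ′-strategy , σ′-moves = ρ ,
    record { strategy = ρ-strategy
           ; subset   = λ v∈ → [ At.subset , p─q⊆p S A ∘ D.subset ]′ (x∈p∪q⁻ A D v∈)
           ; closed   = closed } ,
    cycles-good
      (λ v∈A → Progress-map At.closed (λ v∈A v∉B w∈ → subst (_ ∈_) (ρ-A v∈A v∉B) w∈)
        v∈A (At.progress v∈A))
      (τ-good ρ-B)
      (λ c → let c′ , eq = transfer ((A ∪ D) ─ A)
                   (λ {v} _ (v∈ , w∈ , w∈ρ) → (in-D v∈ , in-D w∈ ,
                      rest-moves (in-D v∈) (x∈p─q⇒x∉q (A ∪ D) A w∈) w∈ρ) , w∈)
                   (start c) c in
             trans (cong parity (sym eq)) (good c′))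
    where
    module At = Attraction at
    module D = Traps traps

    outside-B ρ : EdgeSet
    outside-B = merge A At.moves σ′
    ρ = merge B τ outside-B

    ρ-strategy : IsStrategy 𝓖 P S ρ
    ρ-strategy = merge-strategy (λ _ → strategyAt τ-strategy)
      (λ _ → strategyAt (merge-strategy (λ _ → strategyAt At.strategy) (λ _ → strategyAt σ′-strategy)))

    ρ-B : v ∈ B → ρ v ≡ τ v
    ρ-B = merge-∈ τ outside-B

    ρ-A : v ∈ A → v ∉ B → ρ v ≡ At.moves v
    ρ-A v∈A v∉B = trans (merge-∉ τ outside-B v∉B) (merge-∈ At.moves σ′ v∈A)

    ρ-rest : v ∉ A → ρ v ≡ σ′ v
    ρ-rest v∉A = trans (merge-∉ τ outside-B (v∉A ∘ At.target)) (merge-∉ At.moves σ′ v∉A)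

    D∩A=∅ : Disjoint D A
    D∩A=∅ v∈D = x∈p─q⇒x∉q S A (D.subset v∈D)

    rest-moves : v ∈ D → w ∉ A → w ∈ ρ v → w ∈ σ v
    rest-moves {w = w} v∈D w∉A w∈ρ
      with w∈σ′ ← subst (w ∈_) (ρ-rest (D∩A=∅ v∈D)) w∈ρ
      with σ′-moves (D.subset v∈D) w∈σ′
    ... | inj₁ w∈σ = w∈σ
    -- A move added by `extend` leaves `S ─ A` but not `S`, so it would end in `A`.
    ... | inj₂ (w∉S─A , _) = contradiction
      (x∈p∧x∉q⇒x∈p─q (proj₁ (proj₂ (IsStrategy.edges σ′-strategy w∈σ′))) w∉A) w∉S─A

    closed : v ∈ A ∪ D → w ∈ ρ v → w ∈ A ∪ D
    closed {v} {w} v∈ w∈ρ = by-cases (v ∈? B) (v ∈? A) (w ∈? A)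
      where
      by-cases : Dec (v ∈ B) → Dec (v ∈ A) → Dec (w ∈ A) → w ∈ A ∪ D
      by-cases (yes v∈B) _         _         = τ-closed v∈B (subst (w ∈_) (ρ-B v∈B) w∈ρ)
      by-cases (no _)    _         (yes w∈A) = p⊆p∪q D w∈A
      by-cases (no v∉B)  (yes v∈A) (no _)    =
        p⊆p∪q D (At.closed v∈A v∉B (subst (w ∈_) (ρ-A v∈A v∉B) w∈ρ))
      by-cases (no _)    (no v∉A)  (no w∉A)  = q⊆p∪q A D (D.closed v∈D (rest-moves v∈D w∉A w∈ρ))
        where
        v∈D : v ∈ D
        v∈D = [ (λ v∈A → contradiction v∈A v∉A) , (λ v∈D → v∈D) ]′ (x∈p∪q⁻ A D v∈)

    in-D : v ∈ (A ∪ D) ─ A → v ∈ D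
    in-D v∈ = [ (λ v∈A → contradiction v∈A (x∈p─q⇒x∉q (A ∪ D) A v∈)) , (λ v∈D → v∈D) ]′
      (x∈p∪q⁻ A D (p─q⊆p (A ∪ D) A v∈))

    start : TransClosure (Restriction ρ ((A ∪ D) ─ A)) v w → v ∈ (A ∪ D) ─ A
    start [ v∈ , _ ]     = v∈
    start ((v∈ , _) ∷ _) = v∈

  ⊥-dominion : IsSubgame S → IsDominion 𝓖 P S ⊥
  ⊥-dominion {S} sub = full S ,
    record { strategy = full-strategy sub
           ; subset   = λ v∈ → contradiction v∈ ∉⊥
           ; closed   = λ v∈ → contradiction v∈ ∉⊥ } ,
    λ { [ v∈ , _ ] → contradiction v∈ ∉⊥ ; ((v∈ , _) ∷ _) → contradiction v∈ ∉⊥ }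

  -- Determinacy by Zielonka's argument.

  Determined : Vertices → Set
  Determined S = ∃ λ (W : Player → Vertices) →
    (∀ P → IsDominion 𝓖 P S (W P)) × (∀ {v} → v ∈ S → ∃ λ P → v ∈ W P)

  determined-by : IsDominion 𝓖 P S D → IsDominion 𝓖 (P ⁻¹) S T →
                  (∀ {v} → v ∈ S → v ∈ D ⊎ v ∈ T) → Determined S
  determined-by {Even} {D = D} {T} domD domT cover =
    (λ { Even → D ; Odd → T }) , (λ { Even → domD ; Odd → domT }) ,
    λ v∈S → [ (λ v∈ → Even , v∈) , (λ v∈ → Odd , v∈) ]′ (cover v∈S)
  determined-by {Odd} {D = D} {T} domD domT cover =
    (λ { Odd → D ; Even → T }) , (λ { Odd → domD ; Even → domT }) ,
    λ v∈S → [ (λ v∈ → Odd , v∈) , (λ v∈ → Even , v∈) ]′ (cover v∈S)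

  dominion-subset : IsDominion 𝓖 P S D → D ⊆ S
  dominion-subset (_ , traps , _) = Traps.subset traps

  -- Induction on the subgame for a fixed bound `d`. The argument `lower` stands for the induction
  -- on `d`, so that the case 0, where the remainder is empty, and the successor case share one
  -- proof.
  determined-step : ∀ d →
    (∀ {S A} → IsSubgame S → Bounded d S → IsAttractor 𝓖 (parity d) S (π⁻¹ (+ d) ∩ S) A →
       Determined (S ─ A)) →
    Acc _⊂_ S → IsSubgame S → Bounded d S → Determined S
  determined-step {S} d lower (acc rec) sub bound
    with A , at , co ← attraction (parity d) {B = π⁻¹ (+ d) ∩ S} sub (p∩q⊆q (π⁻¹ (+ d)) S)
    with W , dom , cover ← lower sub bound (attraction-maximal at co)
    with nonempty? (W (parity d ⁻¹))
  -- The player of parity `d` wins everywhere: a cycle through a vertex of priority `d` has highest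
  -- priority exactly `d`, since `d` bounds all of `S`.
  ... | no empty = determined-by
    (dominion-attract sub at (dom (parity d)) (full-strategy sub)
      (λ _ w∈ → whole (proj₁ (proj₂ (IsStrategy.edges (full-strategy {P = parity d} sub) w∈))))
      (λ _ v∈B c → cong parity (ℕ.≤-antisym (highest-bounded in-S c)
        (subst (_≤ highest 𝓖 c) (∈π⁻¹⁻ (p∩q⊆p (π⁻¹ (+ d)) S v∈B)) (highest-start c)))))
    (⊥-dominion sub)
    (inj₁ ∘ whole)
    where
    in-S : Bounded d (A ∪ W (parity d))
    in-S v∈ = bound ([ Attraction.subset at , p─q⊆p S A ∘ dominion-subset (dom (parity d)) ]′
                      (x∈p∪q⁻ A (W (parity d)) v∈))

    whole : v ∈ S → v ∈ A ∪ W (parity d)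
    whole {v} v∈S with v ∈? A
    ... | yes v∈A = p⊆p∪q (W (parity d)) v∈A
    ... | no  v∉A with cover (x∈p∧x∉q⇒x∈p─q v∈S v∉A)
    ...   | P , v∈W with P ℙ.≟ parity d
    ...     | yes refl = q⊆p∪q A (W (parity d)) v∈W
    ...     | no  P≢   = contradiction (v , subst (λ P → v ∈ W P) (≢⇒≡-opponent p≢p⁻¹ P≢) v∈W) empty
  -- The opponent's dominion lifts from the trap `S ─ A` to `S`. Its attractor `A′` is non-empty, so
  -- the induction applies to `S ─ A′`; there the opponent's part is joined with `A′`, and the other
  -- part lifts to `S`.
  ... | yes (x , x∈W)
    with domW@(σ , traps , good) ← dominion-lift sub co (dom (parity d ⁻¹))
    with A′ , at′ , co′ ← attraction (parity d ⁻¹) sub (dominion-subset domW)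
    with x∈A′ ← Attraction.target at′ x∈W
    with W′ , dom′ , cover′ ← determined-step d lower
           (rec (p∩q≢∅⇒p─q⊂p S A′ (x , x∈p∩q⁺ (Attraction.subset at′ x∈A′ , x∈A′))))
           (Trap⇒IsSubgame sub co′) (bound ∘ p─q⊆p S A′) = determined-by
    (dominion-attract sub at′ (dom′ (parity d ⁻¹)) (Traps.strategy traps)
      (λ v∈W w∈σ → p⊆p∪q (W′ (parity d ⁻¹)) (Attraction.target at′ (Traps.closed traps v∈W w∈σ)))
      -- A cycle starting in the lifted dominion follows its strategy and never leaves it.
      (λ ρ≡σ v∈W c →
        let c′ , eq = transfer (W (parity d ⁻¹))
              (λ {_} {w} v∈W (_ , _ , w∈ρ) → let w∈σ = subst (w ∈_) (ρ≡σ v∈W) w∈ρ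
                                                 w∈W = Traps.closed traps v∈W w∈σ in
                (v∈W , w∈W , w∈σ) , w∈W) v∈W c in
        trans (cong parity (sym eq)) (good c′)))
    (dominion-lift sub co′ (dom′ (parity d ⁻¹ ⁻¹)))
    cover-S
    where
    cover-S : v ∈ S → v ∈ A′ ∪ W′ (parity d ⁻¹) ⊎ v ∈ W′ (parity d ⁻¹ ⁻¹)
    cover-S {v} v∈S with v ∈? A′
    ... | yes v∈A′ = inj₁ (p⊆p∪q (W′ (parity d ⁻¹)) v∈A′)
    ... | no  v∉A′ with cover′ (x∈p∧x∉q⇒x∈p─q v∈S v∉A′)
    ...   | P , v∈W′ with P ℙ.≟ (parity d ⁻¹)
    ...     | yes refl = inj₁ (q⊆p∪q A′ (W′ (parity d ⁻¹)) v∈W′)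
    ...     | no  P≢   = inj₂ (subst (λ P → v ∈ W′ P) (≢⇒≡-opponent p≢p⁻¹ P≢) v∈W′)

  determined : ∀ d → IsSubgame S → Bounded d S → Determined S
  determined {S} zero = determined-step zero
    (λ {S} {A} sub bound att →
      let sub′ = complement-subgame sub att in
      (λ _ → ⊥) , (λ _ → ⊥-dominion sub′) , λ {v} v∈ → contradiction (v , v∈) (below-zero bound att))
    (⊂-wellFounded S)
  determined {S} (suc d) = determined-step (suc d)
    (λ sub bound att → determined d (complement-subgame sub att) (below-top bound att))
    (⊂-wellFounded S)

  -- Correctness of the algorithm.

  total-⊤ : IsSubgame ⊤
  total-⊤ {v} _ = let w , w∈ = total v in w , ∈⊤ , w∈

  -- Both parities of `d` are instances. The level of `P` is `d` and that of the opponent is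
  -- `suc d`, matching `univ-captures` and `univ-excludes`.
  univ-largest : ∀ d → (∀ v → π v ≤ d) → parity d ≡ P → ∀ t t′ →
    (∃ λ D → IsLargestDominion 𝓖 P ⊤ D × EmbedsDominion 𝓖 d t P D) →
    (∃ λ D → IsLargestDominion 𝓖 (P ⁻¹) ⊤ D × EmbedsDominion 𝓖 d t′ (P ⁻¹) D) →
    ∃ λ U → (Univ 𝓖 P ⊤ (+ d) t t′ Returns U) × IsLargestDominion 𝓖 P ⊤ U
  univ-largest {P} d bound refl t t′
    (D , largest@((_ , trapsD , _) , maxD) , embD) (D′ , ((_ , trapsD′ , _) , maxD′) , embD′)
    with U , univ ← univ-exists total-⊤ P (+ d) t t′ =
    U , (univ , λ univ′ → univ-unique univ′ univ) ,
    subst (IsLargestDominion 𝓖 P ⊤) (⊆-antisym D⊆U U⊆D) largest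
    where
    own-level : level P d ≡ d
    own-level = cong (if_then d else suc d) (dec-true (parity d ℙ.≟ P) refl)

    opponent-level : level (P ⁻¹) d ≡ suc d
    opponent-level = cong (if_then d else suc d) (dec-false (parity d ℙ.≟ (P ⁻¹)) p≢p⁻¹)

    D⊆U : D ⊆ U
    D⊆U = let 𝓗 , emb = subst (λ e → ∃ λ (𝓗 : Decomposition 𝓖 P e D) → t Embeds tree 𝓖 𝓗)
                         own-level embD in
      univ-captures total-⊤ (λ {v} _ → bound v) univ (Traps⇒Trap trapsD) 𝓗 emb

    D′∩U=∅ : Disjoint D′ U
    D′∩U=∅ = let 𝓗 , emb = subst (λ e → ∃ λ (𝓗 : Decomposition 𝓖 (P ⁻¹) e D′) → t′ Embeds tree 𝓖 𝓗)
                             opponent-level embD′ in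
      univ-excludes total-⊤ (λ {v} _ → bound v) univ refl (Traps⇒Trap trapsD′) 𝓗 emb

    U⊆D : U ⊆ D
    U⊆D v∈U with W , dom , cover ← determined d total-⊤ (λ {v} _ → bound v)
            with Q , v∈W ← cover ∈⊤
            with Q ℙ.≟ P
    ... | yes refl = maxD (W Q) (dom Q) v∈W
    ... | no  Q≢P with refl ← ≢⇒≡-opponent p≢p⁻¹ Q≢P =
      contradiction v∈U (D′∩U=∅ (maxD′ (W Q) (dom Q) v∈W))

theorem13 : (d : ℕ) (𝓖 : ParityGame) → (∀ v → ParityGame.π 𝓖 v ≤ d) →
    (𝓣ᴱ 𝓣ᴼ : Tree) →
    (∃ λ D → IsLargestDominion 𝓖 Even ⊤ D × EmbedsDominion 𝓖 d 𝓣ᴱ Even D) →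
    (∃ λ D → IsLargestDominion 𝓖 Odd ⊤ D × EmbedsDominion 𝓖 d 𝓣ᴼ Odd D) →
    (parity d ≡ Even →
    ∃ λ U → (UnivEven 𝓖 ⊤ (+ d) 𝓣ᴱ 𝓣ᴼ Returns U) × IsLargestDominion 𝓖 Even ⊤ U) ×
    (parity d ≡ Odd →
    ∃ λ U → (UnivOdd 𝓖 ⊤ (+ d) 𝓣ᴱ 𝓣ᴼ Returns U) × IsLargestDominion 𝓖 Odd ⊤ U)
theorem13 d 𝓖 bound 𝓣ᴱ 𝓣ᴼ even odd =
  (λ d-even → univ-largest 𝓖 d bound d-even 𝓣ᴱ 𝓣ᴼ even odd) ,
  (λ d-odd  → univ-largest 𝓖 d bound d-odd 𝓣ᴼ 𝓣ᴱ odd even)
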